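{- Let $n\ge 1$ and let $\mathbf{w}\in\mathcal{K}_{m+}\setminus\{\mathbf{0}\}\subset\mathbb{R}^n$. For $i=1,\dots,n$ let $$\tau_i=\Bigl(\sum_{j=1}^i w_j\Bigr)^{ -1},\qquad \mathbf{b}^{(i)}=[\,\underbrace{\tau_i,\dots,\tau_i}_{i\text{ entries}},0,\dots,0\,]^T\in\mathbb{R}^n,$$ let $\mathcal{B}=\{\mathbf{b}^{(1)},\dots,\mathbf{b}^{(n)}\}$, and let $$\mathcal{A}=\{\mathbf{Q}\,\mathbf{b}:\ \mathbf{Q}\in\mathcal{P}_{\pm},\ \mathbf{b}\in\mathcal{B}\}.$$ Then, for every $\mathbf{x}\in\mathbb{R}^n$, $\ \|\mathbf{x}\|_{\mathcal{A}}=\Omega_{\mathbf{w}}(\mathbf{x})$.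
   Context: $\mathcal{K}_{m+}=\{\mathbf{x}\in\mathbb{R}^n: x_1\ge x_2\ge\cdots\ge x_n\ge 0\}$ is the monotone non-negative cone. The ordered weighted $\ell_1$ (OWL) norm with weights $\mathbf{w}\in\mathcal{K}_{m+}$ is $\Omega_{\mathbf{w}}(\mathbf{x})=\sum_{i=1}^n w_i\,|x|_{[i]}$, where $|x|_{[1]}\ge|x|_{[2]}\ge\cdots\ge|x|_{[n]}$ are the absolute values of the components of $\mathbf{x}$ sorted in non-increasing order. $\mathcal{P}_{\pm}$ is the group of $n\times n$ signed permutation matrices, i.e., matrices with entries in $\{0,-1,+1\}$ such that the sum of absolute values in each row and in each column equals $1$. For a set of atoms $\mathcal{A}\subset\mathbb{R}^n$, the atomic norm is $\|\mathbf{x}\|_{\mathcal{A}}=\inf\{t\ge 0:\ \mathbf{x}\in t\,\mathrm{conv}(\mathcal{A})\}$, where $\mathrm{conv}$ denotes the convex hull. -}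

module Defs where

open import Algebra.Bundles using (CommutativeRing)
open import Algebra.Core using (Op₁; Op₂)
open import Algebra.Definitions using (Congruent₁)
open import Algebra.Structures using (IsCommutativeRing)
import Algebra.Construct.NaturalChoice.Max as Max
import Algebra.Definitions.RawMonoid as RawMonoid
open import Data.Bool.Base using (if_then_else_)
open import Data.Fin.Base as Fin using (Fin; toℕ; inject≤)
open import Data.Fin.Properties as Fin using (toℕ<n)
open import Data.List.Base using (List; length; lookup)
open import Data.List.Properties using (length-tabulate)
open import Data.List.Relation.Binary.Permutation.Propositional.Properties using (↭-length)
import Data.List.Sort as Sort
open import Data.Nat.Base using (ℕ; suc)
open import Data.Product.Base using (Σ-syntax; ∃-syntax; _×_)
open import Data.Sum.Base using (_⊎_)
open import Data.Vec.Functional using (Vector; toList)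
open import Level using (Level; _⊔_) renaming (suc to lsuc)
open import Relation.Binary.Bundles using (DecTotalOrder; TotalOrder)
open import Relation.Binary.Core using (Rel)
open import Relation.Binary.Structures using (IsDecTotalOrder)
import Relation.Binary.Construct.Flip.EqAndOrd as Flip
open import Relation.Binary.PropositionalEquality using (_≡_; sym; trans)
open import Relation.Nullary.Decidable.Core using (does)
open import Relation.Nullary.Negation.Core using (¬_)
open import Relation.Unary using (Pred; _∈_; Satisfiable)

module _ {c ℓ : Level} {A : Set c} (_≤_ : Rel A ℓ) {p : Level} (S : Pred A p) where

  UpperBound LowerBound : Pred A (c ⊔ ℓ ⊔ p)
  UpperBound u = ∀ s → s ∈ S → s ≤ u
  LowerBound l = ∀ s → s ∈ S → l ≤ s

  IsSupremum IsInfimum : Pred A (c ⊔ ℓ ⊔ p)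
  IsSupremum u = u ∈ UpperBound × (∀ v → v ∈ UpperBound → u ≤ v)
  IsInfimum  l = l ∈ LowerBound × (∀ v → v ∈ LowerBound → v ≤ l)

-- The real numbers, given by the axioms that determine them up to isomorphism
-- in classical mathematics.  The order is decidable, as it is classically.
-- The inverse is a total operation, left unspecified at 0#.

record CompleteOrderedField c ℓ₁ ℓ₂ : Set (lsuc (c ⊔ ℓ₁ ⊔ ℓ₂)) where
  infix  9 _⁻¹
  infix  8 -_
  infixl 7 _*_
  infixl 6 _+_
  infix  4 _≈_ _≤_
  field
    Carrier           : Set c
    _≈_               : Rel Carrier ℓ₁
    _≤_               : Rel Carrier ℓ₂
    _+_ _*_           : Op₂ Carrier
    -_ _⁻¹            : Op₁ Carrier
    0# 1#             : Carrier
    isCommutativeRing : IsCommutativeRing _≈_ _+_ _*_ -_ 0# 1#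
    isDecTotalOrder   : IsDecTotalOrder _≈_ _≤_
    0≉1               : ¬ (0# ≈ 1#)
    ⁻¹-cong           : Congruent₁ _≈_ _⁻¹
    ⁻¹-inverseʳ       : ∀ x → ¬ (x ≈ 0#) → x * x ⁻¹ ≈ 1#
    +-monoˡ-≤         : ∀ z {x y} → x ≤ y → x + z ≤ y + z
    *-nonNegative     : ∀ {x y} → 0# ≤ x → 0# ≤ y → 0# ≤ x * y
    complete          : ∀ (S : Pred Carrier (c ⊔ ℓ₁ ⊔ ℓ₂)) →
                        Satisfiable S → Satisfiable (UpperBound _≤_ S) →
                        Satisfiable (IsSupremum _≤_ S)

  commutativeRing : CommutativeRing c ℓ₁
  commutativeRing = record { isCommutativeRing = isCommutativeRing }

  decTotalOrder : DecTotalOrder c ℓ₁ ℓ₂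
  decTotalOrder = record { isDecTotalOrder = isDecTotalOrder }

  totalOrder : TotalOrder c ℓ₁ ℓ₂
  totalOrder = DecTotalOrder.totalOrder decTotalOrder

module OWL {c ℓ₁ ℓ₂ : Level} (ℝ : CompleteOrderedField c ℓ₁ ℓ₂) where

  open CompleteOrderedField ℝ
  open RawMonoid (CommutativeRing.+-rawMonoid commutativeRing) using (sum)
  open Max totalOrder using () renaming (_⊔_ to max)

  -- Sorting along the reversed order, hence into non-increasing order.
  open Sort (Flip.decTotalOrder decTotalOrder) using (sort; sort-↭)

  infix  4 _≋_
  infixr 7 _·_ _∙_

  Vec : ℕ → Set c
  Vec n = Vector Carrier n

  Matrix : ℕ → Set c
  Matrix n = Vector (Vec n) n

  _≋_ : ∀ {n} → Rel (Vec n) ℓ₁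
  x ≋ y = ∀ i → x i ≈ y i

  𝟎 : ∀ {n} → Vec n
  𝟎 _ = 0#

  _·_ : ∀ {n} → Carrier → Vec n → Vec n
  (t · x) i = t * x i

  _∙_ : ∀ {n} → Matrix n → Vec n → Vec n
  (Q ∙ x) i = sum (λ j → Q i j * x j)

  ∣_∣ : Carrier → Carrier
  ∣ x ∣ = max x (- x)

  MonotoneNonNeg : ∀ {n} → Pred (Vec n) ℓ₂
  MonotoneNonNeg x = (∀ i j → i Fin.≤ j → x j ≤ x i) × (∀ i → 0# ≤ x i)

  absList : ∀ {n} → Vec n → List Carrier
  absList x = toList (λ i → ∣ x i ∣)

  length-sort-absList : ∀ {n} (x : Vec n) → length (sort (absList x)) ≡ n
  length-sort-absList x =
    trans (↭-length (sort-↭ (absList x))) (length-tabulate (λ i → ∣ x i ∣))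

  ∣_∣[_] : ∀ {n} → Vec n → Vec n
  ∣ x ∣[ i ] = lookup (sort (absList x)) (Fin.cast (sym (length-sort-absList x)) i)

  Ω : ∀ {n} → Vec n → Vec n → Carrier
  Ω w x = sum (λ i → w i * ∣ x ∣[ i ])

  SignedPermutation : ∀ {n} → Pred (Matrix n) ℓ₁
  SignedPermutation Q =
    (∀ i j → Q i j ≈ 0# ⊎ Q i j ≈ - 1# ⊎ Q i j ≈ 1#) ×
    (∀ i → sum (λ j → ∣ Q i j ∣) ≈ 1#) ×
    (∀ j → sum (λ i → ∣ Q i j ∣) ≈ 1#)

  -- Indices start at zero, so i : Fin n stands for the index toℕ i + 1.
  τ : ∀ {n} → Vec n → Vec n
  τ w i = sum (λ (j : Fin (suc (toℕ i))) → w (inject≤ j (toℕ<n i))) ⁻¹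

  b : ∀ {n} → Vec n → Fin n → Vec n
  b w i j = if does (j Fin.≤? i) then τ w i else 0#

  𝓑 : ∀ {n} → Vec n → Pred (Vec n) ℓ₁
  𝓑 w v = ∃[ i ] v ≋ b w i

  𝓐 : ∀ {n} → Vec n → Pred (Vec n) (c ⊔ ℓ₁)
  𝓐 w a = ∃[ Q ] ∃[ v ] Q ∈ SignedPermutation × v ∈ 𝓑 w × a ≋ Q ∙ v

  conv : ∀ {n p} → Pred (Vec n) p → Pred (Vec n) (c ⊔ ℓ₁ ⊔ ℓ₂ ⊔ p)
  conv {n} A y =
    Σ[ m ∈ ℕ ] Σ[ coeff ∈ Vec m ] Σ[ point ∈ Vector (Vec n) m ]
      (∀ k → 0# ≤ coeff k) ×
      sum coeff ≈ 1# ×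
      (∀ k → point k ∈ A) ×
      y ≋ (λ i → sum (λ k → coeff k * point k i))

  scale : ∀ {n p} → Carrier → Pred (Vec n) p → Pred (Vec n) (c ⊔ ℓ₁ ⊔ p)
  scale t S x = ∃[ y ] y ∈ S × x ≋ t · y

  -- "r is the atomic norm of x": a relation rather than a function of x, since
  -- the infimum is a real number only if x lies in some t · conv A.
  IsAtomicNorm : ∀ {n p} → Pred (Vec n) p → Vec n → Pred Carrier (c ⊔ ℓ₁ ⊔ ℓ₂ ⊔ p)
  IsAtomicNorm A x = IsInfimum _≤_ (λ t → 0# ≤ t × x ∈ scale t (conv A))

{-# OPTIONS --safe #-}

-- Ω is attained by a linear functional: if π sorts |x| and s is the sign
-- vector of x, then Ω x = L x with L y = Σᵢ wᵢ s(π i) y(π i).  Since w is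
-- non-increasing, L is at most 1 on every atom, so Ω x ≤ t for x ∈ t conv 𝓐.
-- Conversely, with m = |x| sorted and mₙ₊₁ = 0, summation by parts writes x
-- as a combination of the atoms Q b⁽ᵏ⁾, with the one signed permutation Q
-- that undoes the sorting, the weights being (mₖ − mₖ₊₁)(w₁ + … + wₖ) ≥ 0;
-- they add up to Ω x.
module Submission where

open import Defs
open import Data.Nat.Base as ℕ using (ℕ)
open import Relation.Nullary.Negation.Core using (¬_)
open import Relation.Unary using (_∈_)

open import Algebra.Bundles using (CommutativeRing)
import Algebra.Construct.NaturalChoice.Max as Max
import Algebra.Properties.Ring as RingProperties
import Algebra.Properties.Semiring.Sum as Sum
import Algebra.Solver.Ring.NaturalCoefficients.Default as SemiringSolver
open import Data.Bool.Base using (true; false; if_then_else_)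
open import Data.Fin.Base as Fin using (Fin; zero; suc; toℕ; inject≤; cast)
open import Data.Fin.Properties as Fin using (toℕ<n; cast-involutive)
open import Data.Fin.Permutation as Perm using (Permutation; _⟨$⟩ˡ_; _⟨$⟩ʳ_; _∘ₚ_)
open import Data.List.Base using (lookup)
open import Data.List.Properties using (length-tabulate; lookup-tabulate)
open import Data.List.Relation.Binary.Permutation.Homogeneous using (onIndices)
open import Data.List.Relation.Binary.Permutation.Propositional using (↭⇒↭ₛ)
import Data.List.Relation.Binary.Permutation.Setoid.Properties as Permutation
import Data.List.Relation.Unary.Sorted.TotalOrder.Properties as Sorted
import Data.List.Sort as Sort
import Data.Nat.Properties as ℕ
open import Data.Product.Base using (∃-syntax; _×_; _,_; proj₁; proj₂)
open import Data.Sum.Base using (_⊎_; inj₁; inj₂; [_,_]′)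
open import Data.Vec.Functional using (Vector; head; tail)
open import Function.Base using (_∘_; _$_)
open import Level using (Level)
open import Relation.Binary.Bundles using (DecTotalOrder)
import Relation.Binary.Construct.Flip.EqAndOrd as Flip
open import Relation.Binary.PropositionalEquality as ≡ using (_≡_)
import Relation.Binary.Reasoning.PartialOrder as PosetReasoning
open import Relation.Nullary.Decidable.Core using (Dec; does; yes; no)
open import Relation.Nullary.Negation.Core using (contradiction)
open import Relation.Unary using (Pred; Satisfiable)

module OrderedField {c ℓ₁ ℓ₂ : Level} (ℝ : CompleteOrderedField c ℓ₁ ℓ₂) where

  open CompleteOrderedField ℝ
  open OWL ℝ
  open CommutativeRing commutativeRing public
    using (semiring; commutativeSemiring; ring; refl; sym; trans; reflexive;
           +-cong; +-congˡ; +-congʳ; +-comm; +-assoc; +-identityˡ; +-identityʳ;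
           -‿cong; -‿inverseˡ; -‿inverseʳ; *-cong; *-congˡ; *-congʳ; *-assoc;
           *-comm; *-identityˡ; *-identityʳ; zeroˡ; zeroʳ)
  open DecTotalOrder decTotalOrder public
    using (poset; total; antisym; _≟_; _≤?_; ≤-respˡ-≈; ≤-respʳ-≈)
    renaming (refl to ≤-refl; trans to ≤-trans)
  open RingProperties ring public using (-1*x≈-x; -‿involutive)
  open Max totalOrder using (x≤x⊔y; x≤y⊔x; ⊔-cong; x≤y⇒x⊔y≈y; x≤y⇒y⊔x≈y)
  open SemiringSolver commutativeSemiring public
    using (solve; _:=_; _:+_; _:*_)
  open Sum semiring public
    using (sum; sum-cong-≋; sum-replicate-zero; ∑-distrib-+; ∑-comm; sum-permute;
           *-distribˡ-sum; *-distribʳ-sum)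
  open PosetReasoning poset

  -- Order arithmetic in the field.

  +-monoʳ-≤ : ∀ z {x y} → x ≤ y → z + x ≤ z + y
  +-monoʳ-≤ z {x} {y} x≤y = begin
    z + x ≈⟨ +-comm z x ⟩
    x + z ≤⟨ +-monoˡ-≤ z x≤y ⟩
    y + z ≈⟨ +-comm y z ⟩
    z + y ∎

  +-mono-≤ : ∀ {x y u v} → x ≤ y → u ≤ v → x + u ≤ y + v
  +-mono-≤ {y = y} {u = u} x≤y u≤v = ≤-trans (+-monoˡ-≤ u x≤y) (+-monoʳ-≤ y u≤v)

  +-cancelʳ-≤ : ∀ z {x y} → x + z ≤ y + z → x ≤ y
  +-cancelʳ-≤ z {x} {y} p = begin
    x             ≈⟨ lemma x ⟨
    x + z + (- z) ≤⟨ +-monoˡ-≤ (- z) p ⟩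
    y + z + (- z) ≈⟨ lemma y ⟩
    y             ∎
    where
    lemma : ∀ x → x + z + (- z) ≈ x
    lemma x = trans (+-assoc x z (- z)) (trans (+-congˡ (-‿inverseʳ z)) (+-identityʳ x))

  x-y+y≈x : ∀ x y → x + - y + y ≈ x
  x-y+y≈x x y = trans (+-assoc x (- y) y) (trans (+-congˡ (-‿inverseˡ y)) (+-identityʳ x))

  x≤y⇒0≤y-x : ∀ {x y} → x ≤ y → 0# ≤ y + (- x)
  x≤y⇒0≤y-x {x} {y} x≤y = ≤-respˡ-≈ (-‿inverseʳ x) (+-monoˡ-≤ (- x) x≤y)

  0≤y-x⇒x≤y : ∀ {x y} → 0# ≤ y + (- x) → x ≤ y
  0≤y-x⇒x≤y {x} {y} p = +-cancelʳ-≤ (- x) (≤-respˡ-≈ (sym (-‿inverseʳ x)) p)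

  x≤0⇒0≤-x : ∀ {x} → x ≤ 0# → 0# ≤ - x
  x≤0⇒0≤-x {x} x≤0 = ≤-respʳ-≈ (+-identityˡ (- x)) (x≤y⇒0≤y-x x≤0)

  0≤x⇒-x≤0 : ∀ {x} → 0# ≤ x → - x ≤ 0#
  0≤x⇒-x≤0 {x} 0≤x = 0≤y-x⇒x≤y (≤-respʳ-≈ (sym (trans (+-identityˡ _) (-‿involutive x))) 0≤x)

  -- The right side exceeds the left by `(y - x) * (v - u)`, a product of non-negative factors.
  *-rearrange : ∀ {x y u v} → x ≤ y → u ≤ v → x * v + y * u ≤ x * u + y * v
  *-rearrange {x} {y} {u} {v} x≤y u≤v = begin
    -- Writing `y` as `p + x` and `v` as `q + u` removes all subtraction, so that a semiring
    -- identity finishes.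
    x * v + y * u             ≈⟨ +-cong (*-congˡ (x-y+y≈x v u)) (*-congʳ (x-y+y≈x y x)) ⟨
    x * (q + u) + (p + x) * u ≈⟨ +-identityʳ _ ⟨
    x * (q + u) + (p + x) * u + 0#
      ≤⟨ +-monoʳ-≤ _ (*-nonNegative (x≤y⇒0≤y-x x≤y) (x≤y⇒0≤y-x u≤v)) ⟩
    x * (q + u) + (p + x) * u + p * q
      ≈⟨ solve 4 (λ x u p q →
           x :* (q :+ u) :+ (p :+ x) :* u :+ p :* q := x :* u :+ (p :+ x) :* (q :+ u)) refl x u p q ⟩
    x * u + (p + x) * (q + u) ≈⟨ +-congˡ (*-cong (x-y+y≈x y x) (x-y+y≈x v u)) ⟩
    x * u + y * v             ∎
    where
    p q : Carrier
    p = y + - x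
    q = v + - u

  *-monoˡ-≤ : ∀ {z x y} → 0# ≤ z → x ≤ y → z * x ≤ z * y
  *-monoˡ-≤ {z} {x} {y} 0≤z x≤y = begin
    z * x          ≈⟨ trans (+-congʳ (zeroˡ y)) (+-identityˡ _) ⟨
    0# * y + z * x ≤⟨ *-rearrange 0≤z x≤y ⟩
    0# * x + z * y ≈⟨ trans (+-congʳ (zeroˡ x)) (+-identityˡ _) ⟩
    z * y          ∎

  -1*-1≈1 : - 1# * - 1# ≈ 1#
  -1*-1≈1 = trans (-1*x≈-x (- 1#)) (-‿involutive 1#)

  -- If `1# ≤ 0#`, then `- 1#` is non-negative, and so is its square, which is `1#`.
  0≤1 : 0# ≤ 1#
  0≤1 = [ (λ p → p) , (λ 1≤0 → ≤-respʳ-≈ -1*-1≈1 (*-nonNegative (x≤0⇒0≤-x 1≤0) (x≤0⇒0≤-x 1≤0))) ]′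
        (total 0# 1#)

  1≰0 : ¬ (1# ≤ 0#)
  1≰0 1≤0 = 0≉1 (antisym 0≤1 1≤0)

  -- A non-positive inverse would make `x * x ⁻¹`, that is `1#`, non-positive.
  ⁻¹-nonNegative : ∀ {x} → 0# ≤ x → ¬ (x ≈ 0#) → 0# ≤ x ⁻¹
  ⁻¹-nonNegative {x} 0≤x x≉0 =
    [ (λ p → p) , (λ x⁻¹≤0 → contradiction (1≤0 x⁻¹≤0) 1≰0) ]′ (total 0# (x ⁻¹))
    where
    1≤0 : x ⁻¹ ≤ 0# → 1# ≤ 0#
    1≤0 x⁻¹≤0 = begin
      1#       ≈⟨ ⁻¹-inverseʳ x x≉0 ⟨
      x * x ⁻¹ ≤⟨ *-monoˡ-≤ 0≤x x⁻¹≤0 ⟩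
      x * 0#   ≈⟨ zeroʳ x ⟩
      0#       ∎

  -- Absolute value and sign.

  x≤∣x∣ : ∀ x → x ≤ ∣ x ∣
  x≤∣x∣ x = x≤x⊔y x (- x)

  -x≤∣x∣ : ∀ x → - x ≤ ∣ x ∣
  -x≤∣x∣ x = x≤y⊔x x (- x)

  ∣∣-cong : ∀ {x y} → x ≈ y → ∣ x ∣ ≈ ∣ y ∣
  ∣∣-cong x≈y = ⊔-cong x≈y (-‿cong x≈y)

  0≤x⇒∣x∣≈x : ∀ {x} → 0# ≤ x → ∣ x ∣ ≈ x
  0≤x⇒∣x∣≈x 0≤x = x≤y⇒y⊔x≈y (≤-trans (0≤x⇒-x≤0 0≤x) 0≤x)

  x≤0⇒∣x∣≈-x : ∀ {x} → x ≤ 0# → ∣ x ∣ ≈ - x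
  x≤0⇒∣x∣≈-x x≤0 = x≤y⇒x⊔y≈y (≤-trans x≤0 (x≤0⇒0≤-x x≤0))

  0≤∣x∣ : ∀ x → 0# ≤ ∣ x ∣
  0≤∣x∣ x = [ (λ 0≤x → ≤-trans 0≤x (x≤∣x∣ x))
            , (λ x≤0 → ≤-trans (x≤0⇒0≤-x x≤0) (-x≤∣x∣ x)) ]′ (total 0# x)

  -- The sign of zero is `1#`, so a sign is always a unit and can be a nonzero entry of a signed
  -- permutation matrix.
  sgn : Carrier → Carrier
  sgn x = if does (0# ≤? x) then 1# else - 1#

  sgn-±1 : ∀ x → sgn x ≈ - 1# ⊎ sgn x ≈ 1#
  sgn-±1 x with does (0# ≤? x)
  ... | true  = inj₂ refl
  ... | false = inj₁ refl

  sgn*x≈∣x∣ : ∀ x → sgn x * x ≈ ∣ x ∣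
  sgn*x≈∣x∣ x with 0# ≤? x
  ... | yes 0≤x = trans (*-identityˡ x) (sym (0≤x⇒∣x∣≈x 0≤x))
  ... | no  0≰x = trans (-1*x≈-x x) (sym (x≤0⇒∣x∣≈-x x≤0))
    where
    x≤0 : x ≤ 0#
    x≤0 = [ (λ 0≤x → contradiction 0≤x 0≰x) , (λ p → p) ]′ (total 0# x)

  sgn*sgn≈1 : ∀ x → sgn x * sgn x ≈ 1#
  sgn*sgn≈1 x = [ (λ p → trans (*-cong p p) -1*-1≈1)
                , (λ p → trans (*-cong p p) (*-identityˡ 1#)) ]′ (sgn-±1 x)

  sgn*∣x∣≈x : ∀ x → sgn x * ∣ x ∣ ≈ x
  sgn*∣x∣≈x x = begin-equality
    sgn x * ∣ x ∣       ≈⟨ *-congˡ (sgn*x≈∣x∣ x) ⟨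
    sgn x * (sgn x * x) ≈⟨ *-assoc _ _ _ ⟨
    sgn x * sgn x * x   ≈⟨ *-congʳ (sgn*sgn≈1 x) ⟩
    1# * x              ≈⟨ *-identityˡ x ⟩
    x                   ∎

  ∣sgn∣≈1 : ∀ x → ∣ sgn x ∣ ≈ 1#
  ∣sgn∣≈1 x = [ (λ p → trans (∣∣-cong p) (trans (x≤0⇒∣x∣≈-x (0≤x⇒-x≤0 0≤1)) (-‿involutive 1#)))
             , (λ p → trans (∣∣-cong p) (0≤x⇒∣x∣≈x 0≤1)) ]′ (sgn-±1 x)

  sgn*y≤∣y∣ : ∀ x y → sgn x * y ≤ ∣ y ∣
  sgn*y≤∣y∣ x y = [ (λ p → ≤-respˡ-≈ (sym (trans (*-congʳ p) (-1*x≈-x y))) (-x≤∣x∣ y))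
                 , (λ p → ≤-respˡ-≈ (sym (trans (*-congʳ p) (*-identityˡ y))) (x≤∣x∣ y)) ]′ (sgn-±1 x)

  -- Finite sums and indicators.

  sum-mono : ∀ {n} {f g : Vec n} → (∀ i → f i ≤ g i) → sum f ≤ sum g
  sum-mono {ℕ.zero}  f≤g = ≤-refl
  sum-mono {ℕ.suc n} f≤g = +-mono-≤ (f≤g zero) (sum-mono (f≤g ∘ suc))

  sum-zero : ∀ {n} {f : Vec n} → f ≋ 𝟎 → sum f ≈ 0#
  sum-zero {n} f≋0 = trans (sum-cong-≋ f≋0) (sum-replicate-zero n)

  sum-nonNegative : ∀ {n} {f : Vec n} → (∀ i → 0# ≤ f i) → 0# ≤ sum f
  sum-nonNegative {n} 0≤f = ≤-respˡ-≈ (sum-replicate-zero n) (sum-mono 0≤f)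

  term≤sum : ∀ {n} {f : Vec n} → (∀ i → 0# ≤ f i) → ∀ i → f i ≤ sum f
  term≤sum {f = f} 0≤f zero    =
    ≤-respˡ-≈ (+-identityʳ (f zero)) (+-monoʳ-≤ (f zero) (sum-nonNegative (0≤f ∘ suc)))
  term≤sum {f = f} 0≤f (suc i) =
    ≤-respˡ-≈ (+-identityˡ (f (suc i))) (+-mono-≤ (0≤f zero) (term≤sum (0≤f ∘ suc) i))

  -- `δ` is the identity matrix; column `k` of `ι`, multiplied by `τ w k`, is the vector `b w k`.
  δ ι : ∀ {n} → Fin n → Fin n → Carrier
  δ i j = if does (i Fin.≟ j) then 1# else 0#
  ι j k = if does (j Fin.≤? k) then 1# else 0#

  -- Delivers the outcome of a decision together with the value it selects, for case splits that
  -- need both.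
  indicator : ∀ {a} {A : Set a} (A? : Dec A) →
              A × (if does A? then 1# else 0#) ≡ 1# ⊎ ¬ A × (if does A? then 1# else 0#) ≡ 0#
  indicator (yes a) = inj₁ (a , ≡.refl)
  indicator (no ¬a) = inj₂ (¬a , ≡.refl)

  δ-sym : ∀ {n} (i j : Fin n) → δ i j ≡ δ j i
  δ-sym zero    zero    = ≡.refl
  δ-sym zero    (suc j) = ≡.refl
  δ-sym (suc i) zero    = ≡.refl
  δ-sym (suc i) (suc j) = δ-sym i j

  sum-δ : ∀ {n} (i : Fin n) (v : Vec n) → sum (λ j → δ i j * v j) ≈ v i
  sum-δ zero    v = trans (+-cong (*-identityˡ _) (sum-zero (λ j → zeroˡ (v (suc j))))) (+-identityʳ _)
  sum-δ (suc i) v = trans (+-cong (zeroˡ _) (sum-δ i (tail v))) (+-identityˡ _)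

  sum-δ-row : ∀ {n} (i : Fin n) → sum (δ i) ≈ 1#
  sum-δ-row i = trans (sum-cong-≋ (λ j → sym (*-identityʳ (δ i j)))) (sum-δ i (λ _ → 1#))

  ι-suc : ∀ {n} (j k : Fin n) → ι (suc j) (suc k) ≡ ι j k
  ι-suc zero    k = ≡.refl
  ι-suc (suc j) k = ≡.refl

  -- Partial sums, telescoping and summation by parts.

  partialSum : ∀ {n} → Vec n → Vec n
  partialSum w i = sum (λ (j : Fin (ℕ.suc (toℕ i))) → w (inject≤ j (toℕ<n i)))

  -- Gives every partial sum the full index range, so that double sums can be exchanged.
  sum-ι : ∀ {n} (w : Vec n) k → sum (λ j → w j * ι j k) ≈ partialSum w k
  sum-ι w zero    = +-cong (*-identityʳ _) (sum-zero (λ j → zeroʳ (w (suc j))))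
  sum-ι w (suc k) = +-cong (*-identityʳ _)
    (trans (sum-cong-≋ (λ j → *-congˡ (reflexive (ι-suc j k)))) (sum-ι (tail w) k))

  private
    -- The default `0#` for the empty vector is the boundary value that follows the last entry.
    head₀ : ∀ {n} → Vec n → Carrier
    head₀ {ℕ.zero}  m = 0#
    head₀ {ℕ.suc n} m = head m

  -- mₖ − mₖ₊₁ at k, where mₙ₊₁ = 0.
  descent : ∀ {n} → Vec n → Vec n
  descent m zero    = m zero + - head₀ (tail m)
  descent m (suc k) = descent (tail m) k

  descent-nonNegative : ∀ {n} {m : Vec n} → m ∈ MonotoneNonNeg → ∀ k → 0# ≤ descent m k
  descent-nonNegative {ℕ.suc ℕ.zero}    (mono , 0≤m) zero    = x≤y⇒0≤y-x (0≤m zero)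
  descent-nonNegative {ℕ.suc (ℕ.suc n)} (mono , 0≤m) zero    = x≤y⇒0≤y-x (mono zero (suc zero) ℕ.z≤n)
  descent-nonNegative                   (mono , 0≤m) (suc k) =
    descent-nonNegative ((λ i j i≤j → mono (suc i) (suc j) (ℕ.s≤s i≤j)) , 0≤m ∘ suc) k

  sum-descent : ∀ {n} (m : Vec n) → sum (descent m) ≈ head₀ m
  sum-descent {ℕ.zero}  m = refl
  sum-descent {ℕ.suc n} m = trans (+-congˡ (sum-descent (tail m)))
    (x-y+y≈x (head m) (head₀ (tail m)))

  -- Only the descents from `j` onwards survive, and they telescope to `m j`.
  sum-descent-ι : ∀ {n} (m : Vec n) j → sum (λ k → descent m k * ι j k) ≈ m j
  sum-descent-ι m zero    = trans (sum-cong-≋ (λ k → *-identityʳ (descent m k))) (sum-descent m)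
  sum-descent-ι m (suc j) = trans
    (+-cong (zeroʳ _) (trans (sum-cong-≋ (λ k → *-congˡ (reflexive (ι-suc j k))))
                          (sum-descent-ι (tail m) j)))
    (+-identityˡ _)

  -- Both sides are the sum of `descent m k * w j` over the pairs with `j` at most `k`, taken in the
  -- two possible orders.
  summation-by-parts : ∀ {n} (w m : Vec n) →
                       sum (λ k → descent m k * partialSum w k) ≈ sum (λ j → w j * m j)
  summation-by-parts w m = begin-equality
    sum (λ k → descent m k * partialSum w k)
      ≈⟨ sum-cong-≋ (λ k → trans (*-congˡ (sym (sum-ι w k)))
                                (*-distribˡ-sum (descent m k) (λ j → w j * ι j k))) ⟩
    sum (λ k → sum (λ j → descent m k * (w j * ι j k)))
      ≈⟨ ∑-comm (λ k j → descent m k * (w j * ι j k)) ⟩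
    sum (λ j → sum (λ k → descent m k * (w j * ι j k)))
      ≈⟨ sum-cong-≋ (λ j → sum-cong-≋ (λ k →
           solve 3 (λ x y z → x :* (y :* z) := y :* (x :* z)) refl (descent m k) (w j) (ι j k))) ⟩
    sum (λ j → sum (λ k → w j * (descent m k * ι j k)))
      ≈⟨ sum-cong-≋ (λ j → trans (sym (*-distribˡ-sum (w j) (λ k → descent m k * ι j k)))
                                (*-congˡ (sum-descent-ι m j))) ⟩
    sum (λ j → w j * m j) ∎

  -- Doubly stochastic matrices and monotone weights.

  DoublyStochastic : ∀ {n} → Pred (Matrix n) _
  DoublyStochastic P =
    (∀ i j → 0# ≤ P i j) × (∀ i → sum (P i) ≈ 1#) × (∀ j → sum (λ i → P i j) ≈ 1#)

  ι-nonNegative : ∀ {n} (j k : Fin n) → 0# ≤ ι j k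
  ι-nonNegative j k with does (j Fin.≤? k)
  ... | true  = 0≤1
  ... | false = ≤-refl

  ι≤1 : ∀ {n} (j k : Fin n) → ι j k ≤ 1#
  ι≤1 j k with does (j Fin.≤? k)
  ... | true  = ≤-refl
  ... | false = 0≤1

  -- With p = P ∙ ι(·,k), which has entries in [0,1] and the same sum as
  -- e = ι(·,k), the terms (wᵢ − wₖ)(eᵢ − pᵢ) are all non-negative.
  doublyStochastic-≤ : ∀ {n} {w : Vec n} → w ∈ MonotoneNonNeg →
                       ∀ {P} → P ∈ DoublyStochastic → ∀ k →
                       sum (λ i → w i * (P ∙ λ j → ι j k) i) ≤ partialSum w k
  -- The same term is added on both sides; on the left `sum p` then becomes `sum e`, which allows a
  -- termwise comparison without subtraction.
  doublyStochastic-≤ {n} {w} (mono , 0≤w) {P} (0≤P , row , col) k = +-cancelʳ-≤ (w k * sum p) $ begin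
    sum (λ i → w i * p i) + w k * sum p           ≈⟨ +-congˡ (*-congˡ sum-p) ⟩
    sum (λ i → w i * p i) + w k * sum e           ≈⟨ +-congˡ (*-distribˡ-sum (w k) e) ⟩
    sum (λ i → w i * p i) + sum (λ i → w k * e i) ≈⟨ ∑-distrib-+ (λ i → w i * p i) (λ i → w k * e i) ⟨
    sum (λ i → w i * p i + w k * e i)             ≤⟨ sum-mono termwise ⟩
    sum (λ i → w i * e i + w k * p i)             ≈⟨ ∑-distrib-+ (λ i → w i * e i) (λ i → w k * p i) ⟩
    sum (λ i → w i * e i) + sum (λ i → w k * p i) ≈⟨ +-cong (sum-ι w k) (sym (*-distribˡ-sum (w k) p)) ⟩
    partialSum w k + w k * sum p                  ∎
    where
    e p : Vec n
    e j = ι j k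
    p = P ∙ e

    0≤p : ∀ i → 0# ≤ p i
    0≤p i = sum-nonNegative (λ j → *-nonNegative (0≤P i j) (ι-nonNegative j k))

    p≤1 : ∀ i → p i ≤ 1#
    p≤1 i = begin
      sum (λ j → P i j * e j) ≤⟨ sum-mono (λ j → *-monoˡ-≤ (0≤P i j) (ι≤1 j k)) ⟩
      sum (λ j → P i j * 1#)  ≈⟨ sum-cong-≋ (λ j → *-identityʳ (P i j)) ⟩
      sum (P i)               ≈⟨ row i ⟩
      1#                      ∎

    sum-p : sum p ≈ sum e
    sum-p = begin-equality
      sum (λ i → sum (λ j → P i j * e j))
        ≈⟨ ∑-comm (λ i j → P i j * e j) ⟩
      sum (λ j → sum (λ i → P i j * e j))
        ≈⟨ sum-cong-≋ (λ j → trans (sym (*-distribʳ-sum (e j) (λ i → P i j)))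
                                   (trans (*-congʳ (col j)) (*-identityˡ _))) ⟩
      sum e ∎

    termwise : ∀ i → w i * p i + w k * e i ≤ w i * e i + w k * p i
    -- Up to `k`, `w i` is at least `w k` and `e i` is 1, at least `p i`; beyond `k` both
    -- comparisons are reversed.
    termwise i = [ (λ (i≤k , eᵢ≡1) → begin
        w i * p i + w k * e i ≈⟨ +-comm _ _ ⟩
        w k * e i + w i * p i ≤⟨ *-rearrange (mono i k i≤k)
                                                (≤-respʳ-≈ (reflexive (≡.sym eᵢ≡1)) (p≤1 i)) ⟩
        w k * p i + w i * e i ≈⟨ +-comm _ _ ⟩
        w i * e i + w k * p i ∎)
      , (λ (i≰k , eᵢ≡0) →
        *-rearrange (mono k i (ℕ.≰⇒≥ i≰k)) (≤-respˡ-≈ (reflexive (≡.sym eᵢ≡0)) (0≤p i)))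
      ]′ (indicator (i Fin.≤? k))

-- The sorted absolute values.

module OWLNorm {c ℓ₁ ℓ₂ : Level} (ℝ : CompleteOrderedField c ℓ₁ ℓ₂) where

  open CompleteOrderedField ℝ
  open OWL ℝ
  open OrderedField ℝ
  open Sort (Flip.decTotalOrder decTotalOrder) using (sort-↭; sort-↗)
  open Permutation (≡.setoid Carrier) using (onIndices-lookup)
  open PosetReasoning poset

  -- The proof that sorting permutes the list contains a bijection of list positions. Both lists
  -- have length `n` only up to a proved equality, hence the casts at either end.
  sorting-permutation : ∀ {n} (x : Vec n) →
                        ∃[ π ] (∀ i → ∣ x ∣[ i ] ≡ ∣ x (π ⟨$⟩ʳ i) ∣)
  sorting-permutation {n} x =
    Perm.cast-id (≡.sym (length-sort-absList x)) ∘ₚ onIndices sort↭ ∘ₚ Perm.cast-id length≡n , eq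
    where
    length≡n = length-tabulate (λ i → ∣ x i ∣)
    sort↭ = ↭⇒↭ₛ (sort-↭ (absList x))

    eq : ∀ i → ∣ x ∣[ i ] ≡ ∣ x (cast length≡n (onIndices sort↭ ⟨$⟩ʳ cast _ i)) ∣
    eq i = ≡.trans (onIndices-lookup sort↭ _) (≡.trans
      (≡.cong (lookup (absList x)) (≡.sym (cast-involutive (≡.sym length≡n) length≡n _)))
      (lookup-tabulate (λ i → ∣ x i ∣) _))

  sorted-monotone : ∀ {n} (x : Vec n) → ∣ x ∣[_] ∈ MonotoneNonNeg
  sorted-monotone x = mono , λ i → ≤-respʳ-≈ (reflexive (≡.sym (eq i))) (0≤∣x∣ _)
    where
    eq = proj₂ (sorting-permutation x)

    mono : ∀ i j → i Fin.≤ j → ∣ x ∣[ j ] ≤ ∣ x ∣[ i ]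
    -- The list is sorted for the flipped order, so monotone lookup there means non-increasing here.
    mono i j i≤j = Sorted.lookup-mono-≤ (Flip.totalOrder totalOrder) (sort-↗ (absList x))
      (≡.subst₂ ℕ._≤_ (≡.sym (Fin.toℕ-cast _ i)) (≡.sym (Fin.toℕ-cast _ j)) i≤j)

  -- Entries of the vectors `b` and conic combinations.

  b≈ι*τ : ∀ {n} (w : Vec n) k j → b w k j ≈ ι j k * τ w k
  b≈ι*τ w k j with does (j Fin.≤? k)
  ... | true  = sym (*-identityˡ _)
  ... | false = sym (zeroˡ _)

  -- A conic combination with weights of sum T is T times a convex one; when
  -- T = 0 all weights vanish, and any point of A will do.
  conic⇒scale : ∀ {n m p} {A : Pred (Vec n) p} → Satisfiable A →
                ∀ {T} {d : Vec m} {a : Vector (Vec n) m} {x : Vec n} →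
                (∀ k → 0# ≤ d k) → sum d ≈ T → (∀ k → a k ∈ A) →
                x ≋ (λ i → sum (λ k → d k * a k i)) →
                x ∈ scale T (conv A)
  conic⇒scale {A = A} (a₀ , a₀∈A) {T} {d} {a} {x} 0≤d sum-d a∈A x≋ with T ≟ 0#
  ... | yes T≈0 = a₀ , (1 , (λ _ → 1#) , (λ _ → a₀) , (λ _ → 0≤1) , +-identityʳ 1# , (λ _ → a₀∈A) ,
                        (λ i → sym (trans (+-identityʳ _) (*-identityˡ (a₀ i))))) ,
    λ i → begin-equality
      x i                     ≈⟨ x≋ i ⟩
      sum (λ k → d k * a k i) ≈⟨ sum-zero (λ k → trans (*-congʳ (d≈0 k)) (zeroˡ (a k i))) ⟩
      0#                      ≈⟨ zeroˡ (a₀ i) ⟨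
      0# * a₀ i               ≈⟨ *-congʳ T≈0 ⟨
      T * a₀ i                ∎
    where
    d≈0 : ∀ k → d k ≈ 0#
    d≈0 k = antisym (≤-respʳ-≈ (trans sum-d T≈0) (term≤sum 0≤d k)) (0≤d k)
  ... | no  T≉0 = _ , (_ , (λ k → T ⁻¹ * d k) , a ,
                       (λ k → *-nonNegative (⁻¹-nonNegative 0≤T T≉0) (0≤d k)) ,
                       sum-coeff , a∈A , λ _ → refl) ,
    λ i → begin-equality
      x i                                      ≈⟨ x≋ i ⟩
      sum (λ k → d k * a k i)                  ≈⟨ sum-cong-≋ (λ k → sym (coeff k i)) ⟩
      sum (λ k → T * (T ⁻¹ * d k * a k i))     ≈⟨ *-distribˡ-sum T (λ k → T ⁻¹ * d k * a k i) ⟨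
      T * sum (λ k → T ⁻¹ * d k * a k i)       ∎
    where
    0≤T : 0# ≤ T
    0≤T = ≤-respʳ-≈ sum-d (sum-nonNegative 0≤d)

    sum-coeff : sum (λ k → T ⁻¹ * d k) ≈ 1#
    sum-coeff = begin-equality
      sum (λ k → T ⁻¹ * d k) ≈⟨ *-distribˡ-sum (T ⁻¹) d ⟨
      T ⁻¹ * sum d           ≈⟨ *-congˡ sum-d ⟩
      T ⁻¹ * T               ≈⟨ *-comm (T ⁻¹) T ⟩
      T * T ⁻¹               ≈⟨ ⁻¹-inverseʳ T T≉0 ⟩
      1#                     ∎

    coeff : ∀ k i → T * (T ⁻¹ * d k * a k i) ≈ d k * a k i
    coeff k i = begin-equality
      T * (T ⁻¹ * d k * a k i) ≈⟨ solve 4 (λ T T⁻¹ d a →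
                                    T :* (T⁻¹ :* d :* a) := T :* T⁻¹ :* (d :* a))
                                    refl T (T ⁻¹) (d k) (a k i) ⟩
      T * T ⁻¹ * (d k * a k i) ≈⟨ *-congʳ (⁻¹-inverseʳ T T≉0) ⟩
      1# * (d k * a k i)       ≈⟨ *-identityˡ _ ⟩
      d k * a k i              ∎

  -- Normalisation by the partial sums of the weights.

  module _ {n : ℕ} {w : Vec (ℕ.suc n)} (w∈K : w ∈ MonotoneNonNeg) (w≉0 : ¬ (w ≋ 𝟎)) where

    private
      0≤w = proj₂ w∈K

    partialSum-nonNegative : ∀ k → 0# ≤ partialSum w k
    partialSum-nonNegative k = sum-nonNegative (λ j → 0≤w (inject≤ j (toℕ<n k)))

    -- Every partial sum contains the first weight, which is the largest; if one vanished, all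
    -- weights would.
    partialSum≉0 : ∀ k → ¬ (partialSum w k ≈ 0#)
    partialSum≉0 k W≈0 = w≉0 λ i → antisym
      (begin
        w i            ≤⟨ proj₁ w∈K zero i ℕ.z≤n ⟩
        w zero         ≤⟨ term≤sum (λ j → 0≤w (inject≤ j (toℕ<n k))) zero ⟩
        partialSum w k ≈⟨ W≈0 ⟩
        0#             ∎)
      (0≤w i)

    partialSum*τ≈1 : ∀ k → partialSum w k * τ w k ≈ 1#
    partialSum*τ≈1 k = ⁻¹-inverseʳ (partialSum w k) (partialSum≉0 k)

    τ-nonNegative : ∀ k → 0# ≤ τ w k
    τ-nonNegative k = ⁻¹-nonNegative (partialSum-nonNegative k) (partialSum≉0 k)

    -- Lower bound by a linear functional.

    -- Signs can only decrease the values, so `Q` may be replaced by its entrywise absolute values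
    -- with rows permuted. This matrix is doubly stochastic, and `τ w k` normalises the resulting
    -- bound `partialSum w k` to 1.
    atom-bound : ∀ (x : Vec (ℕ.suc n)) (π : Permutation (ℕ.suc n) (ℕ.suc n)) {a} → a ∈ 𝓐 w →
                 sum (λ i → w i * (sgn (x i) * a (π ⟨$⟩ʳ i))) ≤ 1#
    atom-bound x π {a} (Q , v , (_ , row , col) , (k , v≋b) , a≋Qv) = begin
      sum (λ i → w i * (sgn (x i) * a (π ⟨$⟩ʳ i)))  ≤⟨ sum-mono (λ i → *-monoˡ-≤ (0≤w i) (entry i)) ⟩
      sum (λ i → w i * (p i * τ w k))               ≈⟨ sum-cong-≋ (λ i → *-assoc (w i) (p i) (τ w k)) ⟨
      sum (λ i → w i * p i * τ w k)                 ≈⟨ *-distribʳ-sum (τ w k) (λ i → w i * p i) ⟨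
      sum (λ i → w i * p i) * τ w k                 ≈⟨ *-comm _ _ ⟩
      τ w k * sum (λ i → w i * p i)                 ≤⟨ *-monoˡ-≤ (τ-nonNegative k)
                                                               (doublyStochastic-≤ w∈K P∈DS k) ⟩
      τ w k * partialSum w k                        ≈⟨ *-comm _ _ ⟩
      partialSum w k * τ w k                        ≈⟨ partialSum*τ≈1 k ⟩
      1#                                            ∎
      where
      P : Matrix (ℕ.suc n)
      P i j = ∣ Q (π ⟨$⟩ʳ i) j ∣

      P∈DS : P ∈ DoublyStochastic
      P∈DS = (λ i j → 0≤∣x∣ _) , (λ i → row (π ⟨$⟩ʳ i)) ,
             -- Permuting the rows leaves each column sum unchanged.
             (λ j → trans (sym (sum-permute (λ i → ∣ Q i j ∣) π)) (col j))

      p : Vec (ℕ.suc n)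
      p = P ∙ λ j → ι j k

      entry : ∀ i → sgn (x i) * a (π ⟨$⟩ʳ i) ≤ p i * τ w k
      entry i = begin
        s * a i′
          ≈⟨ *-congˡ (a≋Qv i′) ⟩
        s * sum (λ j → Q i′ j * v j)
          ≈⟨ *-distribˡ-sum s (λ j → Q i′ j * v j) ⟩
        sum (λ j → s * (Q i′ j * v j))
          -- The non-negative entry of `b w k` moves to the front, as a multiplier of the inequality
          -- for `s * Q i′ j`.
          ≈⟨ sum-cong-≋ (λ j → trans (*-congˡ (*-congˡ (trans (v≋b j) (b≈ι*τ w k j))))
                                     (swap s (Q i′ j) (ι j k * τ w k))) ⟩
        sum (λ j → ι j k * τ w k * (s * Q i′ j))
          ≤⟨ sum-mono (λ j → *-monoˡ-≤ (*-nonNegative (ι-nonNegative j k) (τ-nonNegative k))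
                                       (sgn*y≤∣y∣ (x i) (Q i′ j))) ⟩
        sum (λ j → ι j k * τ w k * P i j)
          ≈⟨ sum-cong-≋ (λ j → rotate (ι j k) (τ w k) (P i j)) ⟩
        sum (λ j → P i j * ι j k * τ w k)
          ≈⟨ *-distribʳ-sum (τ w k) (λ j → P i j * ι j k) ⟨
        p i * τ w k ∎
        where
        s = sgn (x i)
        i′ = π ⟨$⟩ʳ i
        swap = solve 3 (λ s q b → s :* (q :* b) := b :* (s :* q)) refl
        rotate = solve 3 (λ e t p → e :* t :* p := p :* e :* t) refl

    Ω-lowerBound : ∀ x {t} → 0# ≤ t → x ∈ scale t (conv (𝓐 w)) → Ω w x ≤ t
    Ω-lowerBound x {t} 0≤t (y , (m , coeff , a , 0≤c , sum-c , a∈𝓐 , y≋) , x≋ty) = begin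
      Ω w x
        ≈⟨ sum-cong-≋ summand ⟩
      sum (λ i → sum (λ k → t * coeff k * (u i * a k (π ⟨$⟩ʳ i))))
        ≈⟨ ∑-comm (λ i k → t * coeff k * (u i * a k (π ⟨$⟩ʳ i))) ⟩
      sum (λ k → sum (λ i → t * coeff k * (u i * a k (π ⟨$⟩ʳ i))))
        ≈⟨ sum-cong-≋ (λ k → *-distribˡ-sum (t * coeff k) (λ i → u i * a k (π ⟨$⟩ʳ i))) ⟨
      sum (λ k → t * coeff k * L (a k))
        ≤⟨ sum-mono (λ k → *-monoˡ-≤ (*-nonNegative 0≤t (0≤c k)) (L≤1 (a∈𝓐 k))) ⟩
      sum (λ k → t * coeff k * 1#)
        ≈⟨ sum-cong-≋ (λ k → *-identityʳ (t * coeff k)) ⟩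
      sum (λ k → t * coeff k)
        ≈⟨ *-distribˡ-sum t coeff ⟨
      t * sum coeff
        ≈⟨ *-congˡ sum-c ⟩
      t * 1#
        ≈⟨ *-identityʳ t ⟩
      t                                                  ∎
      where
      π = proj₁ (sorting-permutation x)

      u : Vec (ℕ.suc n)
      u i = w i * sgn (x (π ⟨$⟩ʳ i))

      L : Vec (ℕ.suc n) → Carrier
      L y = sum (λ i → u i * y (π ⟨$⟩ʳ i))

      L≤1 : ∀ {a} → a ∈ 𝓐 w → L a ≤ 1#
      L≤1 {a} a∈𝓐 = ≤-respˡ-≈
        (sum-cong-≋ (λ i → sym (*-assoc (w i) (sgn (x (π ⟨$⟩ʳ i))) (a (π ⟨$⟩ʳ i)))))
        -- The signs in `u` are read along `π`, so the bound is applied to `x` composed with `π`.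
        (atom-bound (λ i → x (π ⟨$⟩ʳ i)) π a∈𝓐)

      -- The left side is `u i` times an entry of `x`, so these terms add up to `L x`; the right
      -- side expands `x` into atoms.
      summand : ∀ i → w i * ∣ x ∣[ i ] ≈ sum (λ k → t * coeff k * (u i * a k (π ⟨$⟩ʳ i)))
      summand i = begin-equality
        w i * ∣ x ∣[ i ]
          ≈⟨ *-congˡ (reflexive (proj₂ (sorting-permutation x) i)) ⟩
        w i * ∣ x i′ ∣
          ≈⟨ *-congˡ (sgn*x≈∣x∣ (x i′)) ⟨
        w i * (sgn (x i′) * x i′)
          ≈⟨ *-assoc _ _ _ ⟨
        u i * x i′
          ≈⟨ *-congˡ (trans (x≋ty i′) (*-congˡ (y≋ i′))) ⟩
        u i * (t * sum (λ k → coeff k * a k i′))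
          ≈⟨ *-assoc _ _ _ ⟨
        u i * t * sum (λ k → coeff k * a k i′)
          ≈⟨ *-distribˡ-sum (u i * t) (λ k → coeff k * a k i′) ⟩
        sum (λ k → u i * t * (coeff k * a k i′))
          ≈⟨ sum-cong-≋ (λ k → solve 4 (λ u t c a → u :* t :* (c :* a) := t :* c :* (u :* a))
                                 refl (u i) t (coeff k) (a k i′)) ⟩
        sum (λ k → t * coeff k * (u i * a k i′)) ∎
        where i′ = π ⟨$⟩ʳ i

    -- Decomposition of a vector into atoms.

    Ω-attained : ∀ x → x ∈ scale (Ω w x) (conv (𝓐 w))
    -- `Q ∙ b w zero` is the arbitrary atom for the case where `Ω w x` vanishes; otherwise the
    -- weights are rescaled to sum 1.
    Ω-attained x = conic⇒scale {A = 𝓐 w} (_ , Qb∈𝓐 zero) {a = λ k → Q ∙ b w k}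
      (λ k → *-nonNegative (descent-nonNegative (sorted-monotone x) k) (partialSum-nonNegative k))
      (summation-by-parts w m) Qb∈𝓐 x≋
      where
      m : Vec (ℕ.suc n)
      m = ∣ x ∣[_]
      π = proj₁ (sorting-permutation x)

      -- Row `i` has its only nonzero entry, the sign of `x i`, at the position of `∣ x i ∣` in the
      -- sorted order.
      Q : Matrix (ℕ.suc n)
      Q i j = sgn (x i) * δ (π ⟨$⟩ˡ i) j

      Q-entry : ∀ i j → Q i j ≈ 0# ⊎ Q i j ≈ - 1# ⊎ Q i j ≈ 1#
      Q-entry i j with does (π ⟨$⟩ˡ i Fin.≟ j)
      ... | true  = inj₂ ([ inj₁ ∘ trans (*-identityʳ _) , inj₂ ∘ trans (*-identityʳ _) ]′
                          (sgn-±1 (x i)))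
      ... | false = inj₁ (zeroʳ _)

      ∣Q∣≈δ : ∀ i j → ∣ Q i j ∣ ≈ δ (π ⟨$⟩ˡ i) j
      ∣Q∣≈δ i j with does (π ⟨$⟩ˡ i Fin.≟ j)
      ... | true  = trans (∣∣-cong (*-identityʳ _)) (∣sgn∣≈1 (x i))
      ... | false = trans (∣∣-cong (zeroʳ _)) (0≤x⇒∣x∣≈x ≤-refl)

      Q∈P± : Q ∈ SignedPermutation
      Q∈P± = Q-entry ,
        (λ i → trans (sum-cong-≋ (∣Q∣≈δ i)) (sum-δ-row (π ⟨$⟩ˡ i))) ,
        (λ j → begin-equality
          sum (λ i → ∣ Q i j ∣)        ≈⟨ sum-cong-≋ (λ i → ∣Q∣≈δ i j) ⟩
          -- Reindexing along the inverse of `π` turns this into a column sum of the identity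
          -- matrix.
          sum (λ i → δ (π ⟨$⟩ˡ i) j)   ≈⟨ sum-permute (λ i → δ i j) (Perm.flip π) ⟨
          sum (λ i → δ i j)            ≈⟨ sum-cong-≋ (λ i → reflexive (δ-sym i j)) ⟩
          sum (δ j)                    ≈⟨ sum-δ-row j ⟩
          1#                           ∎)

      Qb∈𝓐 : ∀ k → Q ∙ b w k ∈ 𝓐 w
      Qb∈𝓐 k = Q , b w k , Q∈P± , (k , λ _ → refl) , λ _ → refl

      Qb : ∀ k i → (Q ∙ b w k) i ≈ sgn (x i) * (ι (π ⟨$⟩ˡ i) k * τ w k)
      Qb k i = begin-equality
        sum (λ j → sgn (x i) * δ i′ j * b w k j)
          ≈⟨ sum-cong-≋ (λ j → *-assoc (sgn (x i)) (δ i′ j) (b w k j)) ⟩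
        sum (λ j → sgn (x i) * (δ i′ j * b w k j))
          ≈⟨ *-distribˡ-sum (sgn (x i)) (λ j → δ i′ j * b w k j) ⟨
        sgn (x i) * sum (λ j → δ i′ j * b w k j)
          ≈⟨ *-congˡ (trans (sum-δ i′ (b w k)) (b≈ι*τ w k i′)) ⟩
        sgn (x i) * (ι i′ k * τ w k) ∎
        where i′ = π ⟨$⟩ˡ i

      x≋ : x ≋ λ i → sum (λ k → descent m k * partialSum w k * (Q ∙ b w k) i)
      x≋ i = begin-equality
        x i
          ≈⟨ sgn*∣x∣≈x (x i) ⟨
        s * ∣ x i ∣
          -- Writing `i` as the image of `i′` under `π` exposes the sorted entry `m i′`.
          ≈⟨ *-congˡ (reflexive (≡.cong (λ j → ∣ x j ∣) (≡.sym (Perm.inverseʳ π)))) ⟩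
        s * ∣ x (π ⟨$⟩ʳ i′) ∣
          ≈⟨ *-congˡ (reflexive (≡.sym (proj₂ (sorting-permutation x) i′))) ⟩
        s * m i′
          ≈⟨ *-congˡ (sum-descent-ι m i′) ⟨
        s * sum (λ k → descent m k * ι i′ k)
          ≈⟨ *-distribˡ-sum s (λ k → descent m k * ι i′ k) ⟩
        sum (λ k → s * (descent m k * ι i′ k))
          ≈⟨ sum-cong-≋ (λ k → trans (cancel k) (*-congˡ (sym (Qb k i)))) ⟩
        sum (λ k → descent m k * partialSum w k * (Q ∙ b w k) i) ∎
        where
        s = sgn (x i)
        i′ = π ⟨$⟩ˡ i

        -- The factor 1 is inserted as `partialSum w k * τ w k`: the partial sum goes into the
        -- weight, `τ w k` into the atom.
        cancel : ∀ k → s * (descent m k * ι i′ k) ≈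
                       descent m k * partialSum w k * (s * (ι i′ k * τ w k))
        cancel k = begin-equality
          s * (descent m k * ι i′ k)                              ≈⟨ *-identityˡ _ ⟨
          1# * (s * (descent m k * ι i′ k))                       ≈⟨ *-congʳ (partialSum*τ≈1 k) ⟨
          partialSum w k * τ w k * (s * (descent m k * ι i′ k))
            ≈⟨ solve 5 (λ W τ s d e →
                            W :* τ :* (s :* (d :* e)) := d :* W :* (s :* (e :* τ))) refl
                 (partialSum w k) (τ w k) s (descent m k) (ι i′ k) ⟩
          descent m k * partialSum w k * (s * (ι i′ k * τ w k))   ∎

    Ω-nonNegative : ∀ x → 0# ≤ Ω w x
    Ω-nonNegative x = sum-nonNegative (λ i → *-nonNegative (0≤w i) (proj₂ (sorted-monotone x) i))

theorem1 : ∀ {c ℓ₁ ℓ₂} (ℝ : CompleteOrderedField c ℓ₁ ℓ₂) → let open OWL ℝ in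
    ∀ (n : ℕ) → 1 ℕ.≤ n →
    ∀ (w : Vec n) → w ∈ MonotoneNonNeg → ¬ (w ≋ 𝟎) →
    ∀ (x : Vec n) → IsAtomicNorm (𝓐 w) x (Ω w x)
theorem1 ℝ (ℕ.suc n) _ w w∈K w≉0 x =
  (λ _ (0≤t , x∈tC) → Ω-lowerBound w∈K w≉0 x 0≤t x∈tC) ,
  -- The infimum is attained: `Ω w x` belongs to the set, so every lower bound is at most `Ω w x`.
  (λ _ v-lower → v-lower _ (Ω-nonNegative w∈K w≉0 x , Ω-attained w∈K w≉0 x))
  where open OWLNorm ℝ
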